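{- Let $m\ge 3$ and $s=\lfloor\frac{m+1}{2}\rfloor$. Then $$\mathcal{G}(\mathcal{H}_m) = \mathrm{mex}\{x_3,x_4,\dots,x_s,y_3,y_4,\dots,y_s\},$$ where $x_i=\mathcal{G}(\mathcal{H}_i) \oplus \mathcal{G}(\mathcal{H}_{m+1-i})$ and $y_i=\mathcal{G}(\mathcal{D}_i)\oplus \mathcal{G}(\mathcal{D}_{m+1-i})$ for $i \in \{3,4,\dots,s\}$.
   Context: Toggle: Let $G$ be a finite simple graph, with $N[v]$ the closed neighborhood of $v$. A position $\{G,V_0\}$ consists of $G$ and a set $V_0\subseteq V(G)$ of vertices of weight $0$; all other vertices have weight $1$. Let $\sigma(v)$ be the sum of the weights of the vertices in $N[v]$. A legal move consists of choosing a vertex $v$ of weight $1$ and switching the weight ($0\leftrightarrow 1$) of every vertex of $N[v]$; it is allowed only if $\sigma(v)$ after the switch is strictly smaller than $\sigma(v)$ before it. Two players alternate legal moves; a player with no legal move loses. Nimbers: $\mathcal{G}(\mathcal{S})=\mathrm{mex}\{\mathcal{G}(\mathcal{S}') : \mathcal{S}' \text{ reachable from } \mathcal{S} \text{ by one legal move}\}$, where $\mathrm{mex}(T)$ is the least nonnegative integer not in the finite set $T$ (so $\mathrm{mex}(\emptyset)=0$; lists with upper index less than $3$ are empty). $\oplus$ denotes bitwise XOR of nonnegative integers. $\mathcal{L}_{2,m}$ is the $2\times m$ grid graph with vertices $v_{i,j}$, $0\le i\le 1$, $1\le j\le m$, with edges $v_{0,j}v_{1,j}$ and $v_{i,j}v_{i,j+1}$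 ($1\le j<m$). For $m\ge 4$, $\mathcal{H}_m=\{\mathcal{L}_{2,m},V_0\}$ with $V_0=\{v_{0,1},v_{0,m},v_{1,1},v_{1,2},v_{1,m-1},v_{1,m}\}$; $\mathcal{H}_3=\{\mathcal{L}_{2,3},V_0\}$ with $V_0=\{v_{0,1},v_{0,3},v_{1,1},v_{1,3}\}$. For $m\ge 3$, $\mathcal{D}_m=\{\mathcal{L}_{2,m},V_0\}$ with $V_0=\{v_{0,1},v_{0,m-1},v_{0,m},v_{1,1},v_{1,2},v_{1,m}\}$. -}

module Defs where

open import Data.Bool using (Bool; true; false; not; if_then_else_)
open import Data.Fin using (Fin; toℕ)
open import Data.Fin.Properties using () renaming (_≟_ to _≟ᶠ_)
open import Data.List using (List; []; _∷_; map; filter; applyUpTo; allFin; cartesianProduct)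
open import Data.List.Extrema.Nat using (max; xs≤max)
open import Data.List.Membership.Propositional using (_∈_; _∉_)
open import Data.List.Membership.Propositional.Properties using (∈-cartesianProduct⁺; ∈-allFin)
import Data.List.Membership.DecPropositional as DecMembership
open import Data.List.Properties using (map-cong-local)
open import Data.List.Relation.Unary.All as All using (All; []; _∷_)
import Data.List.Relation.Unary.All.Properties as AllP
open import Data.List.Relation.Unary.Unique.Propositional using (Unique)
import Data.List.Relation.Unary.Unique.Propositional.Properties as UniqueP
open import Data.Nat
open import Data.Nat.DivMod using (_/_; _%_; m/n<m)
open import Data.Nat.ListAction using (sum)
open import Data.Nat.Properties
open import Data.Nat.Tactic.RingSolver using (solve-∀)
open import Data.Product using (_×_; _,_)
open import Data.Product.Properties using (≡-dec)
open import Data.Sum using (_⊎_; inj₁; inj₂)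
open import Level using (0ℓ)
open import Relation.Binary using (Rel; Decidable; DecidableEquality; Symmetric)
open import Relation.Binary.PropositionalEquality
open import Relation.Nullary using (¬_; Dec; yes; no; does; ¬?; contradiction; _×-dec_; _⊎-dec_)

open DecMembership _≟_ using () renaming (_∈?_ to _∈ℕ?_)

------------------------------------------------------------------------
-- Minimal excludant

-- Search upwards from c, making at most k steps.
mexFrom : ℕ → ℕ → List ℕ → ℕ
mexFrom zero    c xs = c
mexFrom (suc k) c xs = if does (c ∈ℕ? xs) then mexFrom k (suc c) xs else c

-- 1 + max xs is not in xs, so the search always has enough steps.
mex : List ℕ → ℕ
mex xs = mexFrom (suc (max 0 xs)) 0 xs

mex-∉ : ∀ xs → mex xs ∉ xs
mex-∉ xs = go (suc (max 0 xs)) 0 (s≤s (m≤m+n _ 0))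
  where
  go : ∀ k c → max 0 xs < k + c → mexFrom k c xs ∉ xs
  go zero    c b c∈ = <⇒≱ b (All.lookup (xs≤max 0 xs) c∈)
  go (suc k) c b with c ∈ℕ? xs
  ... | yes _  = go k (suc c) (subst (max 0 xs <_) (sym (+-suc k c)) b)
  ... | no  c∉ = c∉

mex-least : ∀ xs {n} → n < mex xs → n ∈ xs
mex-least xs = go (suc (max 0 xs)) 0 (λ ())
  where
  go : ∀ k c → (∀ {n} → n < c → n ∈ xs) → ∀ {n} → n < mexFrom k c xs → n ∈ xs
  go zero    c below = below
  go (suc k) c below with c ∈ℕ? xs
  ... | no  _  = below
  ... | yes c∈ = go k (suc c) λ n<1+c → extend (m<1+n⇒m<n∨m≡n n<1+c)
    where
    extend : ∀ {n} → n < c ⊎ n ≡ c → n ∈ xs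
    extend (inj₁ n<c)  = below n<c
    extend (inj₂ refl) = c∈

------------------------------------------------------------------------
-- Bitwise XOR

-- The XOR of the k lowest bits.
xorBits : ℕ → ℕ → ℕ → ℕ
xorBits zero    a b = 0
xorBits (suc k) a b = (a % 2 + b % 2) % 2 + 2 * xorBits k (a / 2) (b / 2)

infixl 6 _⊕_

-- All bits of a and b at positions ≥ a + b vanish.
_⊕_ : ℕ → ℕ → ℕ
a ⊕ b = xorBits (a + b) a b

private
  xorBits-0 : ∀ k → xorBits k 0 0 ≡ 0
  xorBits-0 zero    = refl
  xorBits-0 (suc k) = cong (2 *_) (xorBits-0 k)

  half≤ : ∀ {a k} → a ≤ suc k → a / 2 ≤ k
  half≤ {zero}  _   = z≤n
  half≤ {suc a} a≤k = s≤s⁻¹ (<-≤-trans (m/n<m (suc a) 2 (s≤s (s≤s z≤n))) a≤k)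

  xorBits-cong : ∀ {k l a b} → a ≤ k → b ≤ k → a ≤ l → b ≤ l →
                 xorBits k a b ≡ xorBits l a b
  xorBits-cong {zero}  {l}     z≤n z≤n _ _ = sym (xorBits-0 l)
  xorBits-cong {suc k} {zero}  _ _ z≤n z≤n = xorBits-0 (suc k)
  xorBits-cong {suc k} {suc l} {a} {b} p q r s =
    cong (λ t → (a % 2 + b % 2) % 2 + 2 * t)
         (xorBits-cong (half≤ p) (half≤ q) (half≤ r) (half≤ s))

-- With 0 ⊕ 0 ≡ 0, this recursion characterises bitwise XOR.
⊕-step : ∀ a b → a ⊕ b ≡ (a % 2 + b % 2) % 2 + 2 * (a / 2 ⊕ b / 2)
⊕-step a b = trans
  (xorBits-cong {a + b} {suc K} (m≤m+n a b) (m≤n+m b a)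
     (≤-trans (m≤m+n a b) (≤-trans (m≤m+n _ _) (n≤1+n K)))
     (≤-trans (m≤n+m b a) (≤-trans (m≤m+n _ _) (n≤1+n K))))
  (cong (λ t → (a % 2 + b % 2) % 2 + 2 * t)
     (xorBits-cong {K} {a / 2 + b / 2}
        (≤-trans (m≤m+n _ _) (m≤n+m _ (a + b)))
        (≤-trans (m≤n+m _ (a / 2)) (m≤n+m _ (a + b)))
        (m≤m+n _ _) (m≤n+m _ (a / 2))))
  where
  K = (a + b) + (a / 2 + b / 2)

------------------------------------------------------------------------
-- Finite simple graphs and Toggle

record FiniteSimpleGraph : Set₁ where
  infix 4 _≟ᵥ_ _~_ _~?_
  field
    Vertex   : Set
    _≟ᵥ_     : DecidableEquality Vertex
    vertices : List Vertex
    complete : ∀ v → v ∈ vertices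
    unique   : Unique vertices
    _~_      : Rel Vertex 0ℓ
    _~?_     : Decidable _~_
    ~-sym    : Symmetric _~_
    ~-irrefl : ∀ {v} → ¬ (v ~ v)

module Toggle (G : FiniteSimpleGraph) where
  open FiniteSimpleGraph G

  -- The (decidable) set V₀ of vertices of weight 0.
  ZeroSet : Set
  ZeroSet = Vertex → Bool

  _∈N[_] : Vertex → Vertex → Set
  u ∈N[ v ] = (u ≡ v) ⊎ (v ~ u)

  _∈N[_]? : ∀ u v → Dec (u ∈N[ v ])
  u ∈N[ v ]? = (u ≟ᵥ v) ⊎-dec (v ~? u)

  N[_] : Vertex → List Vertex
  N[ v ] = filter (_∈N[ v ]?) vertices

  weight : ZeroSet → Vertex → ℕ
  weight V₀ v = if V₀ v then 0 else 1

  σ : ZeroSet → Vertex → ℕ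
  σ V₀ v = sum (map (weight V₀) N[ v ])

  switch : ZeroSet → Vertex → ZeroSet
  switch V₀ v u = if does (u ∈N[ v ]?) then not (V₀ u) else V₀ u

  Legal : ZeroSet → Vertex → Set
  Legal V₀ v = (weight V₀ v ≡ 1) × (σ (switch V₀ v) v < σ V₀ v)

  legal? : ∀ V₀ v → Dec (Legal V₀ v)
  legal? V₀ v = (weight V₀ v ≟ 1) ×-dec (σ (switch V₀ v) v <? σ V₀ v)

  options : ZeroSet → List ZeroSet
  options V₀ = map (switch V₀) (filter (legal? V₀) vertices)

  totalWeight : ZeroSet → ℕ
  totalWeight V₀ = sum (map (weight V₀) vertices)

  -- The mex recursion, cut off after k moves.
  nimberWithin : ℕ → ZeroSet → ℕ
  nimberWithin zero    V₀ = 0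
  nimberWithin (suc k) V₀ = mex (map (nimberWithin k) (options V₀))

  -- Every legal move decreases the total weight, so no play is cut off; see
  -- nimber-mex.
  nimber : ZeroSet → ℕ
  nimber V₀ = nimberWithin (totalWeight V₀) V₀

  private
    balance : ∀ V₀ v us →
      sum (map (weight (switch V₀ v)) us) + sum (map (weight V₀) (filter (_∈N[ v ]?) us)) ≡
      sum (map (weight V₀) us) + sum (map (weight (switch V₀ v)) (filter (_∈N[ v ]?) us))
    balance V₀ v []       = refl
    balance V₀ v (u ∷ us) with does (u ∈N[ v ]?) in eq
    ... | false =
      trans (+-assoc (weight V₀ u) _ _)
        (trans (cong (weight V₀ u +_) (balance V₀ v us)) (sym (+-assoc (weight V₀ u) _ _)))
    ... | true rewrite eq =
      trans (exchange (if not (V₀ u) then 0 else 1) _ (weight V₀ u) _)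
        (trans (cong₂ _+_ (+-comm (if not (V₀ u) then 0 else 1) (weight V₀ u)) (balance V₀ v us))
          (sym (exchange (weight V₀ u) _ (if not (V₀ u) then 0 else 1) _)))
      where
      exchange : ∀ a b c d → (a + b) + (c + d) ≡ (a + c) + (b + d)
      exchange = solve-∀

    legal-decreases : ∀ V₀ v → Legal V₀ v → totalWeight (switch V₀ v) < totalWeight V₀
    legal-decreases V₀ v (_ , σ<) = +-cancelʳ-< (σ V₀ v) _ _ (begin-strict
      totalWeight (switch V₀ v) + σ V₀ v  ≡⟨ balance V₀ v vertices ⟩
      totalWeight V₀ + σ (switch V₀ v) v  <⟨ +-monoʳ-< (totalWeight V₀) σ< ⟩
      totalWeight V₀ + σ V₀ v             ∎)
      where open ≤-Reasoning

    options-decrease : ∀ V₀ → All (λ V₁ → totalWeight V₁ < totalWeight V₀) (options V₀)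
    options-decrease V₀ =
      AllP.map⁺ (All.map (λ {v} → legal-decreases V₀ v) (AllP.all-filter (legal? V₀) vertices))

    terminal : ∀ V₀ → totalWeight V₀ ≤ 0 → options V₀ ≡ []
    terminal V₀ t≤0 with options V₀ | options-decrease V₀
    ... | []    | _     = refl
    ... | _ ∷ _ | d ∷ _ = contradiction (<-≤-trans d t≤0) λ ()

    nimberWithin-cong : ∀ k l V₀ → totalWeight V₀ ≤ k → totalWeight V₀ ≤ l →
                        nimberWithin k V₀ ≡ nimberWithin l V₀
    nimberWithin-cong zero    zero    V₀ _ _ = refl
    nimberWithin-cong zero    (suc l) V₀ p _ rewrite terminal V₀ p = refl
    nimberWithin-cong (suc k) zero    V₀ _ q rewrite terminal V₀ q = refl
    nimberWithin-cong (suc k) (suc l) V₀ p q = cong mex (map-cong-local (All.map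
      (λ {V₁} d → nimberWithin-cong k l V₁ (s≤s⁻¹ (<-≤-trans d p)) (s≤s⁻¹ (<-≤-trans d q)))
      (options-decrease V₀)))

  nimber-mex : ∀ V₀ → nimber V₀ ≡ mex (map nimber (options V₀))
  nimber-mex V₀ = trans
    (nimberWithin-cong (totalWeight V₀) (suc (totalWeight V₀)) V₀ ≤-refl (n≤1+n _))
    (cong mex (map-cong-local (All.map
      (λ {V₁} d → nimberWithin-cong (totalWeight V₀) (totalWeight V₁) V₁ (<⇒≤ d) ≤-refl)
      (options-decrease V₀))))

record Position : Set₁ where
  constructor ⟨_,_⟩
  field
    graph   : FiniteSimpleGraph
    zeroSet : Toggle.ZeroSet graph

𝒢 : Position → ℕ
𝒢 ⟨ G , V₀ ⟩ = Toggle.nimber G V₀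

------------------------------------------------------------------------
-- The 2 × m grid; v_{i,j} is the pair (i , j - 1), as Fin m counts from 0.

GridAdj : ∀ {m} → Rel (Fin 2 × Fin m) 0ℓ
GridAdj (i , j) (k , l) =
  (i ≢ k × j ≡ l) ⊎
  (i ≡ k × (toℕ l ≡ suc (toℕ j) ⊎ toℕ j ≡ suc (toℕ l)))

gridAdj? : ∀ {m} → Decidable (GridAdj {m})
gridAdj? (i , j) (k , l) =
  (¬? (i ≟ᶠ k) ×-dec (j ≟ᶠ l)) ⊎-dec
  ((i ≟ᶠ k) ×-dec ((toℕ l ≟ suc (toℕ j)) ⊎-dec (toℕ j ≟ suc (toℕ l))))

gridAdj-sym : ∀ {m} → Symmetric (GridAdj {m})
gridAdj-sym (inj₁ (i≢k , j≡l))    = inj₁ (≢-sym i≢k , sym j≡l)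
gridAdj-sym (inj₂ (i≡k , inj₁ p)) = inj₂ (sym i≡k , inj₂ p)
gridAdj-sym (inj₂ (i≡k , inj₂ p)) = inj₂ (sym i≡k , inj₁ p)

gridAdj-irrefl : ∀ {m} {v : Fin 2 × Fin m} → ¬ GridAdj v v
gridAdj-irrefl (inj₁ (i≢i , _))    = i≢i refl
gridAdj-irrefl (inj₂ (_ , inj₁ p)) = 1+n≢n (sym p)
gridAdj-irrefl (inj₂ (_ , inj₂ p)) = 1+n≢n (sym p)

grid₂ : ℕ → FiniteSimpleGraph
grid₂ m = record
  { Vertex   = Fin 2 × Fin m
  ; _≟ᵥ_     = ≡-dec _≟ᶠ_ _≟ᶠ_
  ; vertices = cartesianProduct (allFin 2) (allFin m)
  ; complete = λ (i , j) → ∈-cartesianProduct⁺ (∈-allFin i) (∈-allFin j)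
  ; unique   = UniqueP.cartesianProduct⁺ (UniqueP.allFin⁺ 2) (UniqueP.allFin⁺ m)
  ; _~_      = GridAdj
  ; _~?_     = gridAdj?
  ; ~-sym    = gridAdj-sym
  ; ~-irrefl = gridAdj-irrefl
  }

open DecMembership (≡-dec _≟_ _≟_) using () renaming (_∈?_ to _∈ℕ²?_)

-- The position on grid₂ m whose weight-0 vertices are the v_{i,j} with
-- (i , j) in the given list, where j counts from 1.
gridPosition : (m : ℕ) → List (ℕ × ℕ) → Position
gridPosition m zs = ⟨ grid₂ m , (λ (i , j) → does ((toℕ i , suc (toℕ j)) ∈ℕ²? zs)) ⟩

-- ℋ m and 𝒟 m are meaningful only for m ≥ 3.
ℋ : ℕ → Position
ℋ 3 = gridPosition 3 ((0 , 1) ∷ (0 , 3) ∷ (1 , 1) ∷ (1 , 3) ∷ [])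
ℋ m = gridPosition m
  ((0 , 1) ∷ (0 , m) ∷ (1 , 1) ∷ (1 , 2) ∷ (1 , m ∸ 1) ∷ (1 , m) ∷ [])

𝒟 : ℕ → Position
𝒟 m = gridPosition m
  ((0 , 1) ∷ (0 , m ∸ 1) ∷ (0 , m) ∷ (1 , 1) ∷ (1 , 2) ∷ (1 , m) ∷ [])

infix 5 _⋯_

-- The list a, a + 1, …, b, empty when b < a.
_⋯_ : ℕ → ℕ → List ℕ
a ⋯ b = applyUpTo (a +_) (suc b ∸ a)

{-# OPTIONS --safe #-}

-- A vertex of a 2 × m grid position that arises in play is legal exactly if it
-- lies in a column of weight 2 whose two neighbouring columns are nonzero and
-- one of its horizontal neighbours has weight 1.  In particular a zero column
-- is never touched again, so it splits the game into a sum of the games on its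
-- two sides.  A move in row 0 of ℋ m creates a zero column i and leaves on its
-- sides 𝒟 i and (with the rows exchanged) 𝒟 (m + 1 - i); a move in row 1 leaves
-- ℋ i and ℋ (m + 1 - i).  The only illegal move among them, in row 1 for m = 5,
-- would lead to nimber 0, as does the move in row 0.

module Submission where

open import Defs
open import Data.Bool using (Bool; true; false; not; if_then_else_; T; T?; _∧_; _∨_; _xor_) renaming (_≟_ to _≟ᵇ_)
open import Data.Bool.Properties using (xor-comm; xor-assoc; xor-same; xor-identityʳ; ∨-comm; ∨-identityʳ)
open import Data.Fin using (Fin; zero; suc; toℕ; fromℕ<; opposite)
open import Data.Fin.Patterns using (0F; 1F; 2F)
import Data.Fin.Properties as Fin
open import Data.List using (List; []; _∷_; map; filter; _++_; length)
open import Data.List.Membership.Propositional using (_∈_)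
open import Data.List.Membership.Propositional.Properties
open import Data.List.Membership.Propositional.Properties.WithK using (unique∧set⇒bag)
open import Data.List.Properties using (map-cong; map-∘; filter-≐)
open import Data.List.Relation.Binary.BagAndSetEquality using (∼bag⇒↭)
open import Data.List.Relation.Binary.Permutation.Propositional using (_↭_)
open import Data.List.Relation.Binary.Permutation.Propositional.Properties using (map⁺)
open import Data.List.Relation.Unary.All using ([]; _∷_)
open import Data.List.Relation.Unary.AllPairs using ([]; _∷_)
open import Data.List.Relation.Unary.Any using (here; there)
open import Data.List.Relation.Unary.Unique.Propositional using (Unique)
open import Data.List.Relation.Unary.Unique.Propositional.Properties using (filter⁺)
open import Data.Nat
open import Data.Nat.DivMod using (_/_; _%_; m/n<m; m≡m%n+[m/n]*n; m%n<n; m*n/n≡m; m/n*n≤m; /-monoˡ-≤)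
open import Data.Nat.ListAction using (sum)
open import Data.Nat.ListAction.Properties using (sum-↭)
open import Data.Nat.Properties
open import Data.Product using (_×_; _,_; ∃-syntax; proj₁; proj₂; swap)
open import Data.Product.Properties using (≡-dec)
open import Data.Sum using (_⊎_; inj₁; inj₂; [_,_]′)
open import Data.Unit using (tt)
open import Function using (mk⇔)
open import Relation.Binary.Definitions using (tri<; tri≈; tri>)
open import Relation.Binary.PropositionalEquality
open import Relation.Nullary using (Dec; does; ¬?; contradiction; _×-dec_; _⊎-dec_; _→-dec_)
open import Relation.Nullary.Decidable using (map′; from-yes; toWitness; does-⇔; dec-true)

-- Nim sums

infixr 5 _∙_ _∷_

-- Appends the lowest bit to `n`. With the factor 2 on the right, `suc n * 2` unfolds to two
-- successors, and `m≡m%n+[m/n]*n` has the same shape.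
_∙_ : Bool → ℕ → ℕ
false ∙ n = n * 2
true  ∙ n = suc (n * 2)

∙-%2 : ∀ b n → (b ∙ n) % 2 ≡ b ∙ 0
∙-%2 false zero    = refl
∙-%2 true  zero    = refl
∙-%2 false (suc n) = ∙-%2 false n
∙-%2 true  (suc n) = ∙-%2 true n

∙-inverse : ∀ n → ∃[ b ] n ≡ b ∙ (n / 2)
∙-inverse n with n % 2 | m%n<n n 2 | m≡m%n+[m/n]*n n 2
... | 0           | _             | eq = false , eq
... | 1           | _             | eq = true , eq
... | suc (suc _) | s≤s (s≤s ()) | _

∙-injective : ∀ x y {m n} → x ∙ m ≡ y ∙ n → x ≡ y × m ≡ n
∙-injective x y {m} {n} eq = bits x y mod , halves x y (bits x y mod) eq
  where
  mod : x ∙ 0 ≡ y ∙ 0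
  mod = trans (sym (∙-%2 x m)) (trans (cong (_% 2) eq) (∙-%2 y n))

  bits : ∀ x y → x ∙ 0 ≡ y ∙ 0 → x ≡ y
  bits false false _ = refl
  bits true  true  _ = refl

  halves : ∀ x y → x ≡ y → x ∙ m ≡ y ∙ n → m ≡ n
  halves false false _ eq = *-cancelʳ-≡ m n 2 eq
  halves true  true  _ eq = *-cancelʳ-≡ m n 2 (suc-injective eq)

∙-/2 : ∀ b n → (b ∙ n) / 2 ≡ n
∙-/2 b n with c , eq ← ∙-inverse (b ∙ n) with refl , eq′ ← ∙-injective b c eq = sym eq′

∙-mono-< : ∀ x y {m n} → m < n → x ∙ m < y ∙ n
∙-mono-< x y {m} {n} m<n = begin-strict
  x ∙ m        ≤⟨ upper x ⟩
  suc (m * 2)  <⟨ ≤-refl ⟩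
  suc m * 2    ≤⟨ *-monoˡ-≤ 2 m<n ⟩
  n * 2        ≤⟨ lower y ⟩
  y ∙ n        ∎
  where
  open ≤-Reasoning
  upper : ∀ x → x ∙ m ≤ suc (m * 2)
  upper false = n≤1+n _
  upper true  = ≤-refl

  lower : ∀ y → n * 2 ≤ y ∙ n
  lower false = ≤-refl
  lower true  = n≤1+n _

-- The order is lexicographic: the lowest bit decides only when the higher digits agree.
∙-cancel-< : ∀ x y {m n} → x ∙ m < y ∙ n → m < n ⊎ (m ≡ n × x ≡ false × y ≡ true)
∙-cancel-< x y {m} {n} lt with <-cmp m n
... | tri< m<n _ _    = inj₁ m<n
... | tri> _ _ n<m    = contradiction (∙-mono-< y x n<m) (<-asym lt)
... | tri≈ _ refl _   with x | y
...   | false | true  = inj₂ (refl , refl , refl)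
...   | false | false = contradiction lt (<-irrefl refl)
...   | true  | true  = contradiction lt (<-irrefl refl)
...   | true  | false = contradiction lt (<-asym ≤-refl)

-- A form of `⊕-step` free of division, suited to induction on digits.
⊕-∙ : ∀ x y m n → (x ∙ m) ⊕ (y ∙ n) ≡ (x xor y) ∙ (m ⊕ n)
⊕-∙ x y m n = trans (⊕-step (x ∙ m) (y ∙ n)) (trans
  (cong₂ (λ p q → p % 2 + 2 * q) (cong₂ _+_ (∙-%2 x m) (∙-%2 y n))
    (cong₂ _⊕_ (∙-/2 x m) (∙-/2 y n)))
  (carry x y))
  where
  carry : ∀ x y → ((x ∙ 0) + (y ∙ 0)) % 2 + 2 * (m ⊕ n) ≡ (x xor y) ∙ (m ⊕ n)
  carry false false = *-comm 2 (m ⊕ n)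
  carry false true  = cong suc (*-comm 2 (m ⊕ n))
  carry true  false = cong suc (*-comm 2 (m ⊕ n))
  carry true  true  = *-comm 2 (m ⊕ n)

-- A common number k of digits for all numbers involved makes the laws of ⊕
-- simultaneous inductions.
data Digits : ℕ → ℕ → Set where
  []  : Digits 0 0
  _∷_ : ∀ b {k n} → Digits k n → Digits (suc k) (b ∙ n)

-- Halving lowers a positive number by at least one, so `n ≤ k` leaves room for all binary digits of
-- `n`.
digits : ∀ k {n} → n ≤ k → Digits k n
digits zero    z≤n = []
digits (suc k) {n} n≤1+k with b , eq ← ∙-inverse n =
  subst (Digits (suc k)) (sym eq) (b ∷ digits k (half n n≤1+k))
  where
  half : ∀ n → n ≤ suc k → n / 2 ≤ k
  half zero    _     = z≤n
  half (suc n) n≤1+k = s≤s⁻¹ (<-≤-trans (m/n<m (suc n) 2 (s≤s (s≤s z≤n))) n≤1+k)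

⊕-comm : ∀ m n → m ⊕ n ≡ n ⊕ m
⊕-comm m n = go (digits (m + n) (m≤m+n m n)) (digits (m + n) (m≤n+m n m))
  where
  go : ∀ {k m n} → Digits k m → Digits k n → m ⊕ n ≡ n ⊕ m
  go []                []                = refl
  go (_∷_ x {n = m} p) (_∷_ y {n = n} q) =
    trans (⊕-∙ x y m n) (trans (cong₂ _∙_ (xor-comm x y) (go p q)) (sym (⊕-∙ y x n m)))

n⊕n≡0 : ∀ n → n ⊕ n ≡ 0
n⊕n≡0 n = go (digits n ≤-refl)
  where
  go : ∀ {k n} → Digits k n → n ⊕ n ≡ 0
  go []                = refl
  go (_∷_ x {n = n} p) = trans (⊕-∙ x x n n) (cong₂ _∙_ (xor-same x) (go p))

xor-cancelʳ : ∀ x y z → x xor z ≡ y xor z → x ≡ y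
xor-cancelʳ x y false eq = trans (sym (xor-identityʳ x)) (trans eq (xor-identityʳ y))
xor-cancelʳ false false true _ = refl
xor-cancelʳ true  true  true _ = refl

⊕-cancelʳ : ∀ l m n → l ⊕ n ≡ m ⊕ n → l ≡ m
⊕-cancelʳ l m n = go
  (digits (l + m + n) (≤-trans (m≤m+n l m) (m≤m+n _ n)))
  (digits (l + m + n) (≤-trans (m≤n+m m l) (m≤m+n _ n)))
  (digits (l + m + n) (m≤n+m n (l + m)))
  where
  go : ∀ {k l m n} → Digits k l → Digits k m → Digits k n → l ⊕ n ≡ m ⊕ n → l ≡ m
  go [] [] [] _ = refl
  go (_∷_ x {n = l} p) (_∷_ y {n = m} q) (_∷_ z {n = n} r) eq
    with xz≡yz , ln≡mn ← ∙-injective (x xor z) (y xor z)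
           (trans (sym (⊕-∙ x z l n)) (trans eq (⊕-∙ y z m n)))
    = cong₂ _∙_ (xor-cancelʳ x y z xz≡yz) (go p q r ln≡mn)

⊕-cancelˡ : ∀ l m n → l ⊕ m ≡ l ⊕ n → m ≡ n
⊕-cancelˡ l m n eq = ⊕-cancelʳ m n l (trans (⊕-comm m l) (trans eq (⊕-comm l n)))

-- The number-theoretic core of the Sprague-Grundy theorem. If the higher digits of `l` are already
-- smaller, a summand is lowered there by induction and its lowest bit can be chosen freely. If they
-- agree, the lowest bit of `l` is 0 and exactly one summand has lowest bit 1, which is cleared.
<⊕⇒decrease : ∀ l m n → l < m ⊕ n →
  (∃[ m′ ] m′ < m × m′ ⊕ n ≡ l) ⊎ (∃[ n′ ] n′ < n × m ⊕ n′ ≡ l)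
<⊕⇒decrease l m n = go
  (digits (l + m + n) (≤-trans (m≤m+n l m) (m≤m+n _ n)))
  (digits (l + m + n) (≤-trans (m≤n+m m l) (m≤m+n _ n)))
  (digits (l + m + n) (m≤n+m n (l + m)))
  where
  go : ∀ {k l m n} → Digits k l → Digits k m → Digits k n → l < m ⊕ n →
    (∃[ m′ ] m′ < m × m′ ⊕ n ≡ l) ⊎ (∃[ n′ ] n′ < n × m ⊕ n′ ≡ l)
  go [] [] [] ()
  go (_∷_ x {n = l} p) (_∷_ y {n = m} q) (_∷_ z {n = n} r) lt
    with ∙-cancel-< x (y xor z) (<-≤-trans lt (≤-reflexive (⊕-∙ y z m n)))
  ... | inj₁ l<m⊕n with go p q r l<m⊕n
  ...   | inj₁ (m′ , m′<m , eq) = inj₁ ((x xor z) ∙ m′ , ∙-mono-< (x xor z) y m′<m ,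
            trans (⊕-∙ (x xor z) z m′ n) (cong₂ _∙_
              (trans (xor-assoc x z z) (trans (cong (x xor_) (xor-same z)) (xor-identityʳ x))) eq))
  ...   | inj₂ (n′ , n′<n , eq) = inj₂ ((y xor x) ∙ n′ , ∙-mono-< (y xor x) z n′<n ,
            trans (⊕-∙ y (y xor x) m n′) (cong₂ _∙_
              (trans (sym (xor-assoc y y x)) (cong (_xor x) (xor-same y))) eq))
  go (_∷_ x {n = l} p) (_∷_ y {n = m} q) (_∷_ z {n = n} r) lt
      | inj₂ (l≡m⊕n , refl , y⊕z) with y | z
  ... | true  | false = inj₁ (false ∙ m , ≤-refl , trans (⊕-∙ false false m n) (cong (false ∙_) (sym l≡m⊕n)))
  ... | false | true  = inj₂ (false ∙ n , ≤-refl , trans (⊕-∙ false false m n) (cong (false ∙_) (sym l≡m⊕n)))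

-- Nimbers of positions

module _ (G : FiniteSimpleGraph) where
  open FiniteSimpleGraph G
  open Toggle G

  legal-≢nimber : ∀ {V v} → Legal V v → nimber (switch V v) ≢ nimber V
  legal-≢nimber {V} {v} legal eq = mex-∉ (map nimber (options V))
    (subst (_∈ map nimber (options V)) (trans eq (nimber-mex V))
      (∈-map⁺ nimber (∈-map⁺ (switch V) (∈-filter⁺ (legal? V) (complete v) legal))))

  <nimber⇒legal : ∀ {V n} → n < nimber V → ∃[ v ] Legal V v × nimber (switch V v) ≡ n
  <nimber⇒legal {V} n<
    with V′ , V′∈ , refl ← ∈-map⁻ nimber
           (mex-least (map nimber (options V)) (<-≤-trans n< (≤-reflexive (nimber-mex V))))
    with v , v∈ , refl ← ∈-map⁻ (switch V) V′∈
    = v , proj₂ (∈-filter⁻ (legal? V) {xs = vertices} v∈) , refl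

  weight-cong : ∀ {V V′} → V ≗ V′ → weight V ≗ weight V′
  weight-cong eq v = cong (if_then 0 else 1) (eq v)

  switch-cong : ∀ {V V′} → V ≗ V′ → ∀ v → switch V v ≗ switch V′ v
  switch-cong eq v u = cong₂ (if_then_else_ _) (cong not (eq u)) (eq u)

  σ-cong : ∀ {V V′} → V ≗ V′ → σ V ≗ σ V′
  σ-cong eq v = cong sum (map-cong (weight-cong eq) N[ v ])

  Legal-cong : ∀ {V V′} → V ≗ V′ → ∀ {v} → Legal V v → Legal V′ v
  Legal-cong eq {v} (w≡1 , σ<) =
    trans (sym (weight-cong eq v)) w≡1 ,
    subst₂ _<_ (σ-cong (switch-cong eq v) v) (σ-cong eq v) σ<

  -- Zero sets are functions and are compared only pointwise, so equality of nimbers has to be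
  -- carried through the recursion, with one cut-off `k` for both positions.
  nimberWithin-cong : ∀ k {V V′} → V ≗ V′ → nimberWithin k V ≡ nimberWithin k V′
  nimberWithin-cong zero    eq = refl
  nimberWithin-cong (suc k) {V} {V′} eq = cong mex (begin
    map (nimberWithin k) (options V)
      ≡⟨ map-∘ _ ⟨
    map (λ v → nimberWithin k (switch V v)) (filter (legal? V) vertices)
      ≡⟨ map-cong (λ v → nimberWithin-cong k (switch-cong eq v)) _ ⟩
    map (λ v → nimberWithin k (switch V′ v)) (filter (legal? V) vertices)
      ≡⟨ cong (map _) (filter-≐ (legal? V) (legal? V′)
           (Legal-cong eq , Legal-cong (λ v → sym (eq v))) vertices) ⟩
    map (λ v → nimberWithin k (switch V′ v)) (filter (legal? V′) vertices)
      ≡⟨ map-∘ _ ⟩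
    map (nimberWithin k) (options V′) ∎)
    where open ≡-Reasoning

  nimber-cong : ∀ {V V′} → V ≗ V′ → nimber V ≡ nimber V′
  nimber-cong {V} eq = trans (nimberWithin-cong (totalWeight V) eq)
    (cong (λ n → nimberWithin n _) (cong sum (map-cong (weight-cong eq) vertices)))

-- With `∀Column?` and `Fin.all?`, this turns claims about a row and a few columns into finite
-- tables checked by evaluation.
∀Bool? : ∀ {P : Bool → Set} → (∀ b → Dec (P b)) → Dec (∀ b → P b)
∀Bool? P? = map′ (λ { (f , t) false → f ; (f , t) true → t }) (λ h → h false , h true)
  (P? false ×-dec P? true)

-- Words of columns

-- A column records where the weight is 1, row 0 first.
Column : Set
Column = Bool × Bool

Word : Set
Word = List Column

pattern 𝟘 = false , false
pattern 𝟙 = true , true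

bit : Column → Fin 2 → Bool
bit (a , b) 0F = a
bit (a , b) 1F = b

flip : Fin 2 → Column → Column
flip 0F (a , b) = not a , b
flip 1F (a , b) = a , not b

nonzero : Column → Bool
nonzero (a , b) = a ∨ b

playable : Fin 2 → Column → Column → Bool
playable r a b = nonzero a ∧ nonzero b ∧ (bit a r ∨ bit b r)

-- Move r c w w′ plays the vertex in row r of column c + 1, counting columns
-- from 0.  On well-formed words these are exactly the legal moves.
data Move (r : Fin 2) : ℕ → Word → Word → Set where
  here  : ∀ {a b w} → T (playable r a b) →
          Move r 0 (a ∷ 𝟙 ∷ b ∷ w) (flip r a ∷ 𝟘 ∷ flip r b ∷ w)
  there : ∀ {a c w w′} → Move r c w w′ → Move r (suc c) (a ∷ w) (a ∷ w′)

Move-length : ∀ {r c w w′} → Move r c w w′ → length w′ ≡ length w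
Move-length (here _)  = refl
Move-length (there m) = cong suc (Move-length m)

size : Word → ℕ
size []      = 0
size (a ∷ w) = (if nonzero a then 1 else 0) + size w

-- The played column becomes `𝟘`, and its two neighbours were already counted as nonzero.
Move-size : ∀ {r c w w′} → Move r c w w′ → size w′ < size w
Move-size {r} (here {a} {b} {w} p) with nonzero a | nonzero b | p
... | true | true | _ = s≤s (+-mono-≤ (≤1 (nonzero (flip r a))) (+-monoˡ-≤ (size w) (≤1 (nonzero (flip r b)))))
  where
  ≤1 : ∀ b → (if b then 1 else 0) ≤ 1
  ≤1 false = z≤n
  ≤1 true  = ≤-refl
Move-size (there {a} m) = +-monoʳ-< (if nonzero a then 1 else 0) (Move-size m)

-- l and r tell whether the columns on the left and on the right of a are nonzero.
stable : Bool → Column → Bool → Bool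
stable l 𝟘               r = true
stable l (true  , false) r = not (l ∧ r)
stable l (false , true)  r = not (l ∧ r)
stable l 𝟙               r = not (l xor r)

headNonzero : Word → Bool
headNonzero []      = false
headNonzero (a ∷ _) = nonzero a

-- l tells whether the column to the left of the word is nonzero; the last
-- column has to be 𝟘.
Stable : Bool → Word → Set
Stable l []      = T (not l)
Stable l (a ∷ w) = T (stable l a (headNonzero w)) × Stable (nonzero a) w

WellFormed : Word → Set
WellFormed w = T (not (headNonzero w)) × Stable false w

-- Invariance of well-formedness under moves

∀Column? : ∀ {P : Column → Set} → (∀ a → Dec (P a)) → Dec (∀ a → P a)
∀Column? P? = map′ (λ h (a , b) → h a b) (λ h a b → h (a , b))
  (∀Bool? λ a → ∀Bool? λ b → P? (a , b))

abstract
  -- A column of weight 1 beside the nonzero played column has `𝟘` as its outer neighbour by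
  -- stability. The disjunction serves that outer neighbour: either it sees no change, or it is `𝟘`
  -- and hence stable in any case.
  stable-flipˡ : ∀ r a b l → T (playable r a b) → T (stable l a true) →
              T (stable l (flip r a) false) × (nonzero (flip r a) ≡ nonzero a ⊎ l ≡ false)
  stable-flipˡ = from-yes (Fin.all? λ r → ∀Column? λ a → ∀Column? λ b → ∀Bool? λ l →
    T? (playable r a b) →-dec T? (stable l a true) →-dec
    T? (stable l (flip r a) false) ×-dec (nonzero (flip r a) ≟ᵇ nonzero a ⊎-dec l ≟ᵇ false))

  stable-flipʳ : ∀ r a b x → T (playable r a b) → T (stable true b x) →
               T (stable false (flip r b) x) × (nonzero (flip r b) ≡ nonzero b ⊎ x ≡ false)
  stable-flipʳ = from-yes (Fin.all? λ r → ∀Column? λ a → ∀Column? λ b → ∀Bool? λ x →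
    T? (playable r a b) →-dec T? (stable true b x) →-dec
    T? (stable false (flip r b) x) ×-dec (nonzero (flip r b) ≟ᵇ nonzero b ⊎-dec x ≟ᵇ false))

playable⇒nonzero : ∀ r a b → T (playable r a b) → nonzero a ≡ true × nonzero b ≡ true
playable⇒nonzero r a b p with nonzero a | nonzero b
... | true | true = refl , refl

Stable-zeroHead : ∀ {l l′} w → headNonzero w ≡ false → w ≢ [] → Stable l w → Stable l′ w
Stable-zeroHead []      _ ≢[] _       = contradiction refl ≢[]
Stable-zeroHead (𝟘 ∷ w) _ _   (_ , s) = _ , s

stable-cong : ∀ l a {x y} → y ≡ x ⊎ nonzero a ≡ false → T (stable l a x) → T (stable l a y)
stable-cong l a (inj₁ refl) s = s
stable-cong l 𝟘 (inj₂ _)    s = tt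

-- The second component strengthens the induction: the column in front of the word stays stable if
-- its right neighbour remains zero or nonzero, or if it is itself `𝟘`.
Move-Stable : ∀ {r c w w′} l → Move r c w w′ → Stable l w →
  Stable l w′ × (headNonzero w′ ≡ headNonzero w ⊎ l ≡ false)
Move-Stable {r} l (here {a} {b} {w} p) (s₁ , s₂ , s₃ , s)
  with na , nb ← playable⇒nonzero r a b p
  with t₁ , h₁ ← stable-flipˡ r a b l p s₁
  with t₃ , h₃ ← stable-flipʳ r a b (headNonzero w) p s₃
  = (t₁ , tt , t₃ , tail h₃) , h₁
  where
  nonempty : Stable (nonzero b) w → w ≢ []
  nonempty s refl = subst (λ x → T (not x)) nb s

  tail : nonzero (flip r b) ≡ nonzero b ⊎ headNonzero w ≡ false → Stable (nonzero (flip r b)) w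
  tail (inj₁ eq) = subst (λ x → Stable x w) (sym eq) s
  tail (inj₂ z)  = Stable-zeroHead w z (nonempty s) s
Move-Stable l (there {a} m) (s , ss) with ss′ , h ← Move-Stable (nonzero a) m ss =
  (stable-cong l a h s , ss′) , inj₁ refl

Move-WellFormed : ∀ {r c w w′} → Move r c w w′ → WellFormed w → WellFormed w′
Move-WellFormed {r} (here {a} {b} p) (z , s) =
  contradiction (subst (λ x → T (not x)) (proj₁ (playable⇒nonzero r a b p)) z) λ ()
Move-WellFormed m@(there _) (z , s) = z , proj₁ (Move-Stable false m s)

-- Splitting a word at a column `𝟘`

Stable-++ˡ : ∀ l u v → Stable l (u ++ 𝟘 ∷ v) → Stable l (u ++ 𝟘 ∷ [])
Stable-++ˡ l []          v (_ , _) = tt , tt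
Stable-++ˡ l (a ∷ [])    v (t , s) = t , Stable-++ˡ (nonzero a) [] v s
Stable-++ˡ l (a ∷ b ∷ u) v (t , s) = t , Stable-++ˡ (nonzero a) (b ∷ u) v s

Stable-++ʳ : ∀ l u v → Stable l (u ++ 𝟘 ∷ v) → Stable false (𝟘 ∷ v)
Stable-++ʳ l []      v s       = _ , proj₂ s
Stable-++ʳ l (a ∷ u) v (_ , s) = Stable-++ʳ (nonzero a) u v s

WellFormed-++ˡ : ∀ u v → WellFormed (u ++ 𝟘 ∷ v) → WellFormed (u ++ 𝟘 ∷ [])
WellFormed-++ˡ []      v (z , s) = z , Stable-++ˡ false [] v s
WellFormed-++ˡ (a ∷ u) v (z , s) = z , Stable-++ˡ false (a ∷ u) v s

WellFormed-++ʳ : ∀ u v → WellFormed (u ++ 𝟘 ∷ v) → WellFormed (𝟘 ∷ v)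
WellFormed-++ʳ u v (_ , s) = _ , Stable-++ʳ false u v s

Move-++ˡ : ∀ {r c w} u v → Move r c (u ++ 𝟘 ∷ []) w →
  ∃[ u′ ] w ≡ u′ ++ 𝟘 ∷ [] × Move r c (u ++ 𝟘 ∷ v) (u′ ++ 𝟘 ∷ v)
Move-++ˡ {r} (a ∷ 𝟙 ∷ []) v (here p) with () ← proj₂ (playable⇒nonzero r a 𝟘 p)
Move-++ˡ {r} (a ∷ 𝟙 ∷ b ∷ u) v (here p) = flip r a ∷ 𝟘 ∷ flip r b ∷ u , refl , here p
Move-++ˡ (a ∷ u) v (there m) with u′ , refl , m′ ← Move-++ˡ u v m = a ∷ u′ , refl , there m′
Move-++ˡ [] v (there ())

Move-++ʳ : ∀ {r c w} u v → Move r c (𝟘 ∷ v) w →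
  ∃[ v′ ] w ≡ 𝟘 ∷ v′ × ∃[ c′ ] Move r c′ (u ++ 𝟘 ∷ v) (u ++ 𝟘 ∷ v′)
Move-++ʳ [] v m@(there _) = _ , refl , _ , m
Move-++ʳ (a ∷ u) v m with v′ , eq , c′ , m′ ← Move-++ʳ u v m = v′ , eq , suc c′ , there m′

-- The three columns involved in a move are all nonzero beforehand, so they lie on one side of the
-- separating `𝟘`.
Move-++⁻ : ∀ {r c w} u v → Move r c (u ++ 𝟘 ∷ v) w →
  (∃[ u′ ] w ≡ u′ ++ 𝟘 ∷ v × Move r c (u ++ 𝟘 ∷ []) (u′ ++ 𝟘 ∷ [])) ⊎
  (∃[ v′ ] w ≡ u ++ 𝟘 ∷ v′ × ∃[ c′ ] Move r c′ (𝟘 ∷ v) (𝟘 ∷ v′))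
Move-++⁻ [] v m@(there _) = inj₂ (_ , refl , _ , m)
Move-++⁻ {r} (a ∷ 𝟙 ∷ []) v (here p) with () ← proj₂ (playable⇒nonzero r a 𝟘 p)
Move-++⁻ {r} (a ∷ 𝟙 ∷ b ∷ u) v (here p) = inj₁ (flip r a ∷ 𝟘 ∷ flip r b ∷ u , refl , here p)
Move-++⁻ (a ∷ u) v (there m) with Move-++⁻ u v m
... | inj₁ (u′ , refl , m′) = inj₁ (a ∷ u′ , refl , there m′)
... | inj₂ (v′ , refl , m′) = inj₂ (v′ , refl , m′)

-- Words as grid positions

-- The default `𝟘` beyond the end avoids bounds: a column there can be neither played nor adjacent
-- to a played one.
column : Word → ℕ → Column
column []      _       = 𝟘
column (a ∷ w) zero    = a
column (a ∷ w) (suc j) = column w j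

Move-playable : ∀ {r c w w′} → Move r c w w′ →
  column w (suc c) ≡ 𝟙 × T (playable r (column w c) (column w (2 + c))) × 2 + c < length w
Move-playable (here p)  = refl , p , s≤s (s≤s (s≤s z≤n))
Move-playable (there m) with x , p , c< ← Move-playable m = x , p , s≤s c<

playable⇒Move : ∀ r c w → column w (suc c) ≡ 𝟙 → T (playable r (column w c) (column w (2 + c))) →
  ∃[ w′ ] Move r c w w′
playable⇒Move r zero    (a ∷ 𝟙 ∷ [])    refl p with () ← proj₂ (playable⇒nonzero r a 𝟘 p)
playable⇒Move r zero    (a ∷ 𝟙 ∷ b ∷ w) refl p = _ , here p
playable⇒Move r (suc c) (a ∷ w)         x    p with w′ , m ← playable⇒Move r c w x p = a ∷ w′ , there m

Stable-column : ∀ l w c → Stable l w →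
  T (stable (nonzero (column w c)) (column w (suc c)) (nonzero (column w (2 + c))))
Stable-column l []              c       _             = tt
Stable-column l (a ∷ [])        zero    _             = tt
Stable-column l (a ∷ b ∷ [])    zero    (_ , s , _)   = s
Stable-column l (a ∷ b ∷ d ∷ w) zero    (_ , s , _)   = s
Stable-column l (a ∷ w)         (suc c) (_ , s)       = Stable-column (nonzero a) w c s

Stable-nonzero< : ∀ l w j → Stable l w → T (nonzero (column w j)) → suc j < length w
Stable-nonzero< l (a ∷ [])    zero    (_ , s) nz = contradiction nz (¬T (nonzero a) s)
  where
  ¬T : ∀ b → T (not b) → T b → _
  ¬T true ()
Stable-nonzero< l (a ∷ b ∷ w) zero    _       nz = s≤s (s≤s z≤n)
Stable-nonzero< l (a ∷ w)     (suc j) (_ , s) nz = s≤s (Stable-nonzero< (nonzero a) w j s nz)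

-- Both border columns are `𝟘`, so a vertex of weight 1 has horizontal neighbours on both sides and
-- its closed neighbourhood has four vertices.
WellFormed-nonzero : ∀ w j → WellFormed w → T (nonzero (column w j)) →
  ∃[ c ] j ≡ suc c × 2 + c < length w
WellFormed-nonzero (𝟘 ∷ w) zero    _       ()
WellFormed-nonzero w       (suc c) (_ , s) nz = c , refl , Stable-nonzero< false w (suc c) s nz

-- The negation is due to `ZeroSet` marking weight 0, whereas columns mark weight 1.
render : ∀ {m} → Word → Fin 2 × Fin m → Bool
render w (i , j) = not (bit (column w (toℕ j)) i)

-- The relation `_∈N[_]` of the grid with natural numbers as columns, so that `Move-bit` can shift
-- columns by induction.
Near : Fin 2 → ℕ → Fin 2 → ℕ → Set
Near r c i j = (i ≡ r × j ≡ c) ⊎ (r ≢ i × c ≡ j) ⊎ (r ≡ i × (j ≡ suc c ⊎ c ≡ suc j))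

near? : ∀ r c i j → Dec (Near r c i j)
near? r c i j = (i Fin.≟ r ×-dec j ≟ c) ⊎-dec (¬? (r Fin.≟ i) ×-dec c ≟ j) ⊎-dec
                (r Fin.≟ i ×-dec (j ≟ suc c ⊎-dec c ≟ suc j))

Move-bit : ∀ {r c w w′} → Move r c w w′ → ∀ i j → bit (column w′ j) i ≡
  (if does (near? r (suc c) i j) then not (bit (column w j) i) else bit (column w j) i)
Move-bit {0F} (here _) 0F 0 = refl
Move-bit {0F} (here _) 0F 1 = refl
Move-bit {0F} (here _) 0F 2 = refl
Move-bit {0F} (here _) 0F (suc (suc (suc j))) = refl
Move-bit {0F} (here _) 1F 0 = refl
Move-bit {0F} (here _) 1F 1 = refl
Move-bit {0F} (here _) 1F 2 = refl
Move-bit {0F} (here _) 1F (suc (suc (suc j))) = refl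
Move-bit {1F} (here _) 0F 0 = refl
Move-bit {1F} (here _) 0F 1 = refl
Move-bit {1F} (here _) 0F 2 = refl
Move-bit {1F} (here _) 0F (suc (suc (suc j))) = refl
Move-bit {1F} (here _) 1F 0 = refl
Move-bit {1F} (here _) 1F 1 = refl
Move-bit {1F} (here _) 1F 2 = refl
Move-bit {1F} (here _) 1F (suc (suc (suc j))) = refl
Move-bit {0F} (there _) 0F zero = refl
Move-bit {0F} (there _) 1F zero = refl
Move-bit {1F} (there _) 0F zero = refl
Move-bit {1F} (there _) 1F zero = refl
-- The result of `near?` is unchanged by computation when both columns are shifted by one.
Move-bit      (there m) i  (suc j) = Move-bit m i j

-- Closed neighbourhoods and legality

opposite-≢ : ∀ (r : Fin 2) → r ≢ opposite r
opposite-≢ = toWitness {a? = Fin.all? λ r → ¬? (r Fin.≟ opposite r)} tt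

≢⇒opposite : ∀ (r i : Fin 2) → r ≢ i → i ≡ opposite r
≢⇒opposite = toWitness {a? = Fin.all? λ r → Fin.all? λ i → ¬? (r Fin.≟ i) →-dec i Fin.≟ opposite r} tt

-- The legality of the vertex in row r of the column x between the columns a
-- and b, with the shape of the sums that σ-neighbourhood and σ-switch yield.
LegalBetween : Fin 2 → Column → Column → Column → Set
LegalBetween r a x b =
  (if not (bit x r) then 0 else 1) ≡ 1 ×
  sum (map (λ w → if not (not w) then 0 else 1) ws) < sum (map (λ w → if not w then 0 else 1) ws)
  where ws = bit x r ∷ bit x (opposite r) ∷ bit a r ∷ bit b r ∷ []

legalBetween? : ∀ r a x b → Dec (LegalBetween r a x b)
legalBetween? r a x b = _ ≟ _ ×-dec _ <? _

full? : ∀ x → Dec (x ≡ 𝟙)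
full? x = ≡-dec _≟ᵇ_ _≟ᵇ_ x 𝟙

abstract
  -- Switching four vertices lowers their sum exactly if it was at least 3. In a column of weight 1
  -- this would need two nonzero neighbouring columns, which stability excludes. In a column `𝟙` one
  -- horizontal neighbour of weight 1 suffices, and stability then makes both neighbouring columns
  -- nonzero.
  LegalBetween⇔playable : ∀ r a x b → T (stable (nonzero a) x (nonzero b)) →
    (LegalBetween r a x b → x ≡ 𝟙 × T (playable r a b)) ×
    (x ≡ 𝟙 × T (playable r a b) → LegalBetween r a x b)
  LegalBetween⇔playable = toWitness {a? = Fin.all? λ r → ∀Column? λ a → ∀Column? λ x → ∀Column? λ b →
    T? (stable (nonzero a) x (nonzero b)) →-dec
    (legalBetween? r a x b →-dec full? x ×-dec T? (playable r a b)) ×-dec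
    ((full? x ×-dec T? (playable r a b)) →-dec legalBetween? r a x b)} tt

module _ {m : ℕ} where
  open FiniteSimpleGraph (grid₂ m)
  open Toggle (grid₂ m)

  switch-render : ∀ {r c w w′} {k : Fin m} → Move r c w w′ → toℕ k ≡ suc c →
                  switch (render w) (r , k) ≗ render w′
  switch-render {r} {c} {w} {w′} {k} mv k≡ (i , j) = trans
    (cong (λ b → if b then not (render w (i , j)) else render w (i , j)) (trans
      (does-⇔ (mk⇔ to from) ((i , j) ∈N[ (r , k) ]?) (near? r (toℕ k) i (toℕ j)))
      (cong (λ c → does (near? r c i (toℕ j))) k≡)))
    (trans (push (does (near? r (suc c) i (toℕ j))) (bit (column w (toℕ j)) i))
      (cong not (sym (Move-bit mv i (toℕ j)))))
    where
    push : ∀ b x → (if b then not (not x) else not x) ≡ not (if b then not x else x)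
    push false x = refl
    push true  x = refl

    to : (i , j) ∈N[ (r , k) ] → Near r (toℕ k) i (toℕ j)
    to (inj₁ refl)             = inj₁ (refl , refl)
    to (inj₂ (inj₁ (≢ , refl))) = inj₂ (inj₁ (≢ , refl))
    to (inj₂ (inj₂ p))         = inj₂ (inj₂ p)

    from : Near r (toℕ k) i (toℕ j) → (i , j) ∈N[ (r , k) ]
    from (inj₁ (refl , eq))     = inj₁ (cong (r ,_) (Fin.toℕ-injective eq))
    from (inj₂ (inj₁ (≢ , eq))) = inj₂ (inj₁ (≢ , Fin.toℕ-injective eq))
    from (inj₂ (inj₂ p))        = inj₂ (inj₂ p)

  module _ (r : Fin 2) {k kˡ kʳ : Fin m} (l≡ : toℕ k ≡ suc (toℕ kˡ)) (r≡ : toℕ kʳ ≡ suc (toℕ k)) where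

    neighbourhood : List Vertex
    neighbourhood = (r , k) ∷ (opposite r , k) ∷ (r , kˡ) ∷ (r , kʳ) ∷ []

    ∈N⇒∈ : ∀ {u} → u ∈N[ (r , k) ] → u ∈ neighbourhood
    ∈N⇒∈ (inj₁ refl)                       = here refl
    ∈N⇒∈ (inj₂ (inj₁ (≢ , refl)))          = there (here (cong (_, _) (≢⇒opposite r _ ≢)))
    ∈N⇒∈ (inj₂ (inj₂ (refl , inj₁ eq)))    =
      there (there (there (here (cong (r ,_) (Fin.toℕ-injective (trans eq (sym r≡)))))))
    ∈N⇒∈ (inj₂ (inj₂ (refl , inj₂ eq)))    =
      there (there (here (cong (r ,_) (Fin.toℕ-injective (suc-injective (trans (sym eq) l≡))))))

    ∈⇒∈N : ∀ {u} → u ∈ neighbourhood → u ∈N[ (r , k) ]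
    ∈⇒∈N (here refl)                         = inj₁ refl
    ∈⇒∈N (there (here refl))                 = inj₂ (inj₁ (opposite-≢ r , refl))
    ∈⇒∈N (there (there (here refl)))         = inj₂ (inj₂ (refl , inj₂ l≡))
    ∈⇒∈N (there (there (there (here refl)))) = inj₂ (inj₂ (refl , inj₁ r≡))

    unique-neighbourhood : Unique neighbourhood
    unique-neighbourhood =
      ((λ eq → opposite-≢ r (cong proj₁ eq)) ∷ (λ eq → kˡ≢k (sym (cong proj₂ eq))) ∷
       (λ eq → k≢kʳ (cong proj₂ eq)) ∷ []) ∷
      ((λ eq → kˡ≢k (sym (cong proj₂ eq))) ∷ (λ eq → k≢kʳ (cong proj₂ eq)) ∷ []) ∷
      ((λ eq → kˡ≢kʳ (cong proj₂ eq)) ∷ []) ∷ [] ∷ []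
      where
      kˡ≢k : kˡ ≢ k
      kˡ≢k refl = 1+n≢n (sym l≡)

      k≢kʳ : k ≢ kʳ
      k≢kʳ refl = 1+n≢n (sym r≡)

      kˡ≢kʳ : kˡ ≢ kʳ
      kˡ≢kʳ refl = m≢1+m+n (toℕ kˡ) (trans r≡ (cong suc (trans l≡ (sym (+-comm (toℕ kˡ) 1)))))

    -- Two duplicate-free lists with the same elements are permutations of each other; this reduces
    -- `σ` on a grid of any width to four explicit weights.
    N↭neighbourhood : N[ (r , k) ] ↭ neighbourhood
    N↭neighbourhood = ∼bag⇒↭ (unique∧set⇒bag (filter⁺ (_∈N[ (r , k) ]?) unique) unique-neighbourhood
      (mk⇔ (λ u∈ → ∈N⇒∈ (proj₂ (∈-filter⁻ (_∈N[ (r , k) ]?) {xs = vertices} u∈)))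
           (λ u∈ → ∈-filter⁺ (_∈N[ (r , k) ]?) (complete _) (∈⇒∈N u∈))))

    σ-neighbourhood : ∀ V → σ V (r , k) ≡ sum (map (weight V) neighbourhood)
    σ-neighbourhood V = sum-↭ (map⁺ (weight V) N↭neighbourhood)

    weight-switch : ∀ V {u} → u ∈ neighbourhood →
                    weight (switch V (r , k)) u ≡ (if not (V u) then 0 else 1)
    weight-switch V {u} u∈ = cong (λ b → if (if b then not (V u) else V u) then 0 else 1)
      (dec-true (u ∈N[ (r , k) ]?) (∈⇒∈N u∈))

    σ-switch : ∀ V → σ (switch V (r , k)) (r , k) ≡ sum (map (λ u → if not (V u) then 0 else 1) neighbourhood)
    σ-switch V = trans (σ-neighbourhood (switch V (r , k)))
      (cong₂ _+_ (weight-switch V (here refl)) (cong₂ _+_ (weight-switch V (there (here refl)))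
        (cong₂ _+_ (weight-switch V (there (there (here refl))))
          (cong (_+ 0) (weight-switch V (there (there (there (here refl)))))))))

    module _ {w : Word} (wf : WellFormed w) where
      private
        table = LegalBetween⇔playable r (column w (toℕ kˡ)) (column w (toℕ k)) (column w (toℕ kʳ))
          (subst₂ (λ x y → T (stable (nonzero (column w (toℕ kˡ))) (column w x) (nonzero (column w y))))
            (sym l≡) (trans (cong suc (sym l≡)) (sym r≡)) (Stable-column false w (toℕ kˡ) (proj₂ wf)))

      Legal⇒playable : Legal (render w) (r , k) →
        column w (toℕ k) ≡ 𝟙 × T (playable r (column w (toℕ kˡ)) (column w (toℕ kʳ)))
      Legal⇒playable (w≡1 , σ<) =
        proj₁ table (w≡1 , subst₂ _<_ (σ-switch (render w)) (σ-neighbourhood (render w)) σ<)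

      playable⇒Legal : column w (toℕ k) ≡ 𝟙 →
        T (playable r (column w (toℕ kˡ)) (column w (toℕ kʳ))) → Legal (render w) (r , k)
      playable⇒Legal x p with w≡1 , σ< ← proj₂ table (x , p) =
        w≡1 , subst₂ _<_ (sym (σ-switch (render w))) (sym (σ-neighbourhood (render w))) σ<

Move⇒Legal : ∀ {r c w w′} → WellFormed w → Move r c w w′ →
  ∃[ v ] Toggle.Legal (grid₂ (length w)) (render w) v ×
         Toggle.switch (grid₂ (length w)) (render w) v ≗ render w′
Move⇒Legal {r} {c} {w} wf mv with x , p , c< ← Move-playable mv =
  (r , fromℕ< c₁<) ,
  playable⇒Legal r {kˡ = fromℕ< c₀<} {kʳ = fromℕ< c<}
    (trans k≡ (cong suc (sym kˡ≡))) (trans kʳ≡ (cong suc (sym k≡))) {w = w} wf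
    (trans (cong (column w) k≡) x)
    (subst₂ (λ i j → T (playable r (column w i) (column w j))) (sym kˡ≡) (sym kʳ≡) p) ,
  switch-render mv k≡
  where
  c₁< = <-trans (n<1+n (suc c)) c<
  c₀< = <-trans (n<1+n c) c₁<
  k≡  = Fin.toℕ-fromℕ< c₁<
  kˡ≡ = Fin.toℕ-fromℕ< c₀<
  kʳ≡ = Fin.toℕ-fromℕ< c<

weight⇒nonzero : ∀ r x → (if not (bit x r) then 0 else 1) ≡ 1 → T (nonzero x)
weight⇒nonzero 0F (true , _)     _ = tt
weight⇒nonzero 1F (true , true)  _ = tt
weight⇒nonzero 1F (false , true) _ = tt

Legal⇒Move : ∀ {w v} → WellFormed w → Toggle.Legal (grid₂ (length w)) (render w) v →
  ∃[ r ] ∃[ c ] ∃[ w′ ] Move r c w w′ ×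
  Toggle.switch (grid₂ (length w)) (render w) v ≗ render w′
Legal⇒Move {w} {r , k} wf legal@(w≡1 , _)
  with c , k≡ , c< ← WellFormed-nonzero w (toℕ k) wf (weight⇒nonzero r (column w (toℕ k)) w≡1)
  = r , c , proj₁ move , proj₂ move , switch-render (proj₂ move) k≡
  where
  c₀< = <-trans (n<1+n c) (<-trans (n<1+n (suc c)) c<)
  kˡ≡ = Fin.toℕ-fromℕ< c₀<
  kʳ≡ = Fin.toℕ-fromℕ< c<

  p = Legal⇒playable r {kˡ = fromℕ< c₀<} {kʳ = fromℕ< c<}
        (trans k≡ (cong suc (sym kˡ≡))) (trans kʳ≡ (cong suc (sym k≡))) {w = w} wf legal

  move : ∃[ w′ ] Move r c w w′
  move = playable⇒Move r c w (subst (λ j → column w j ≡ 𝟙) k≡ (proj₁ p))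
    (subst₂ (λ i j → T (playable r (column w i) (column w j))) kˡ≡ kʳ≡ (proj₂ p))

-- Nimbers of words

abstract
  nim : Word → ℕ
  nim w = 𝒢 ⟨ grid₂ (length w) , render w ⟩

  nim-render : ∀ {m} w → length w ≡ m → 𝒢 ⟨ grid₂ m , render w ⟩ ≡ nim w
  nim-render w refl = refl

  nim-switch : ∀ {r c w w′ v} → Move r c w w′ →
    Toggle.switch (grid₂ (length w)) (render w) v ≗ render w′ →
    Toggle.nimber (grid₂ (length w)) (Toggle.switch (grid₂ (length w)) (render w) v) ≡ nim w′
  nim-switch {w = w} {w′} mv sw = trans (nimber-cong (grid₂ (length w)) sw) (nim-render w′ (Move-length mv))

  nim-Move : ∀ {r c w w′} → WellFormed w → Move r c w w′ → nim w′ ≢ nim w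
  nim-Move {w = w} wf mv eq =
    let v , legal , sw = Move⇒Legal wf mv
    in  legal-≢nimber (grid₂ (length w)) {V = render w} legal
          (trans (nim-switch mv sw) (trans eq (sym (nim-render w refl))))

  <nim⇒Move : ∀ {w n} → WellFormed w → n < nim w →
    ∃[ r ] ∃[ c ] ∃[ w′ ] Move r c w w′ × nim w′ ≡ n
  <nim⇒Move {w} wf n< =
    let v , legal , eq = <nimber⇒legal (grid₂ (length w)) {V = render w}
          (<-≤-trans n< (≤-reflexive (sym (nim-render w refl))))
        r , c , w′ , mv , sw = Legal⇒Move {w} wf legal
    in  r , c , w′ , mv , trans (sym (nim-switch mv sw)) eq

-- Sums of games

-- If `nim w` were larger, `n` would be the nimber of an option; if it were smaller, `nim w` itself
-- would be.
nim-≡ : ∀ {w} → WellFormed w → ∀ n →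
  (∀ {r c w′} → Move r c w w′ → nim w′ ≢ n) →
  (∀ {k} → k < n → ∃[ r ] ∃[ c ] ∃[ w′ ] Move r c w w′ × nim w′ ≡ k) →
  nim w ≡ n
nim-≡ {w} wf n avoids reaches with <-cmp (nim w) n
... | tri≈ _ eq _ = eq
... | tri< nim<n _ _ =
  let _ , _ , _ , m , eq = reaches nim<n in contradiction eq (nim-Move wf m)
... | tri> _ _ n<nim =
  let _ , _ , _ , m , eq = <nim⇒Move wf n<nim in contradiction eq (avoids m)

-- The Sprague-Grundy theorem for the two sides, which share the column `𝟘` as a border.
-- Cancellation shows that no move preserves the XOR, and `<⊕⇒decrease` yields a move to every
-- smaller value. The induction is on a bound for `size`.
nim-++ : ∀ u v → WellFormed (u ++ 𝟘 ∷ v) →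
         nim (u ++ 𝟘 ∷ v) ≡ nim (u ++ 𝟘 ∷ []) ⊕ nim (𝟘 ∷ v)
nim-++ u v = go _ u v ≤-refl
  where
  go : ∀ k u v → size (u ++ 𝟘 ∷ v) < k → WellFormed (u ++ 𝟘 ∷ v) →
       nim (u ++ 𝟘 ∷ v) ≡ nim (u ++ 𝟘 ∷ []) ⊕ nim (𝟘 ∷ v)
  go (suc k) u v (s≤s size≤k) wf = nim-≡ wf (nim (u ++ 𝟘 ∷ []) ⊕ nim (𝟘 ∷ v)) avoids reaches
    where
    step : ∀ {r c} u′ v′ → Move r c (u ++ 𝟘 ∷ v) (u′ ++ 𝟘 ∷ v′) →
           nim (u′ ++ 𝟘 ∷ v′) ≡ nim (u′ ++ 𝟘 ∷ []) ⊕ nim (𝟘 ∷ v′)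
    step u′ v′ m = go k u′ v′ (<-≤-trans (Move-size m) size≤k) (Move-WellFormed m wf)

    wfˡ = WellFormed-++ˡ u v wf
    wfʳ = WellFormed-++ʳ u v wf

    avoids : ∀ {r c w′} → Move r c (u ++ 𝟘 ∷ v) w′ → nim w′ ≢ nim (u ++ 𝟘 ∷ []) ⊕ nim (𝟘 ∷ v)
    avoids m eq with Move-++⁻ u v m
    ... | inj₁ (u′ , refl , m′) =
      nim-Move wfˡ m′ (⊕-cancelʳ (nim (u′ ++ 𝟘 ∷ [])) (nim (u ++ 𝟘 ∷ [])) (nim (𝟘 ∷ v)) (trans (sym (step u′ v m)) eq))
    ... | inj₂ (v′ , refl , _ , m′) =
      nim-Move wfʳ m′ (⊕-cancelˡ (nim (u ++ 𝟘 ∷ [])) (nim (𝟘 ∷ v′)) (nim (𝟘 ∷ v)) (trans (sym (step u v′ m)) eq))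

    reaches : ∀ {n} → n < nim (u ++ 𝟘 ∷ []) ⊕ nim (𝟘 ∷ v) →
      ∃[ r ] ∃[ c ] ∃[ w′ ] Move r c (u ++ 𝟘 ∷ v) w′ × nim w′ ≡ n
    reaches {n} n< with <⊕⇒decrease n (nim (u ++ 𝟘 ∷ [])) (nim (𝟘 ∷ v)) n<
    reaches n< | inj₁ (a , a< , eq) with <nim⇒Move wfˡ a<
    ... | r , c , _ , m , refl with Move-++ˡ u v m
    ...   | u′ , refl , m′ = r , c , _ , m′ , trans (step u′ v m′) eq
    reaches n< | inj₂ (b , b< , eq) with <nim⇒Move wfʳ b<
    ... | r , _ , _ , m , refl with Move-++ʳ u v m
    ...   | v′ , refl , c , m′ = r , c , _ , m′ , trans (step u v′ m′) eq

-- Exchanging the rows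

nonzero-swap : ∀ a → nonzero (swap a) ≡ nonzero a
nonzero-swap (a , b) = ∨-comm b a

bit-swap : ∀ r a → bit (swap a) (opposite r) ≡ bit a r
bit-swap 0F a = refl
bit-swap 1F a = refl

flip-swap : ∀ r a → flip (opposite r) (swap a) ≡ swap (flip r a)
flip-swap 0F a = refl
flip-swap 1F a = refl

playable-swap : ∀ r a b → playable (opposite r) (swap a) (swap b) ≡ playable r a b
playable-swap r a b = cong₂ _∧_ (nonzero-swap a) (cong₂ _∧_ (nonzero-swap b)
  (cong₂ _∨_ (bit-swap r a) (bit-swap r b)))

stable-swap : ∀ l a r → stable l (swap a) r ≡ stable l a r
stable-swap l 𝟘              r = refl
stable-swap l (false , true) r = refl
stable-swap l (true , false) r = refl
stable-swap l 𝟙              r = refl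

Move-swap : ∀ {r c w w′} → Move r c w w′ → Move (opposite r) c (map swap w) (map swap w′)
Move-swap {r} (here {a} {b} {w} p) =
  subst₂ (λ x y → Move (opposite r) 0 (swap a ∷ 𝟙 ∷ swap b ∷ map swap w) (x ∷ 𝟘 ∷ y ∷ map swap w))
    (flip-swap r a) (flip-swap r b) (here (subst T (sym (playable-swap r a b)) p))
Move-swap (there m) = there (Move-swap m)

headNonzero-swap : ∀ w → headNonzero (map swap w) ≡ headNonzero w
headNonzero-swap []      = refl
headNonzero-swap (a ∷ w) = nonzero-swap a

Stable-swap : ∀ l w → Stable l w → Stable l (map swap w)
Stable-swap l []      s        = s
Stable-swap l (a ∷ w) (s , ss) =
  subst T (sym (trans (stable-swap l a _) (cong (stable l a) (headNonzero-swap w)))) s ,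
  subst (λ x → Stable x (map swap w)) (sym (nonzero-swap a)) (Stable-swap (nonzero a) w ss)

WellFormed-swap : ∀ w → WellFormed w → WellFormed (map swap w)
WellFormed-swap w (z , s) =
  subst (λ x → T (not x)) (sym (headNonzero-swap w)) z , Stable-swap false w s

swap-involutive : ∀ (w : Word) → map swap (map swap w) ≡ w
swap-involutive []      = refl
swap-involutive (a ∷ w) = cong (a ∷_) (swap-involutive w)

-- Moves correspond under the exchange of rows. As `swap` is an involution, `Move-swap` supplies
-- both directions.
nim-swap : ∀ w → WellFormed w → nim (map swap w) ≡ nim w
nim-swap w = go _ w ≤-refl
  where
  go : ∀ k w → size w < k → WellFormed w → nim (map swap w) ≡ nim w
  go (suc k) w (s≤s size≤k) wf = nim-≡ (WellFormed-swap w wf) _ avoids reaches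
    where
    step : ∀ {r c w′} → Move r c w w′ → nim (map swap w′) ≡ nim w′
    step {w′ = w′} m = go k w′ (<-≤-trans (Move-size m) size≤k) (Move-WellFormed m wf)

    avoids : ∀ {r c w′} → Move r c (map swap w) w′ → nim w′ ≢ nim w
    avoids {r} {c} {w′} m eq = nim-Move wf m′ (trans (sym (step m′))
      (trans (cong nim (swap-involutive w′)) eq))
      where
      m′ : Move (opposite r) c w (map swap w′)
      m′ = subst (λ w → Move (opposite r) c w (map swap w′)) (swap-involutive w) (Move-swap m)

    reaches : ∀ {k} → k < nim w → ∃[ r ] ∃[ c ] ∃[ w′ ] Move r c (map swap w) w′ × nim w′ ≡ k
    reaches k< = let r , c , w′ , m , eq = <nim⇒Move wf k< in
      opposite r , c , map swap w′ , Move-swap m , trans (step m) eq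

-- The segments ℋ and 𝒟

-- The first column is a parameter: it may be an end that is already flipped, while the recursion
-- continues with `𝟙`.
run : Column → ℕ → Fin 2 → Word
run a zero    ρ = flip ρ a ∷ []
run a (suc n) ρ = a ∷ run 𝟙 n ρ

-- Between two columns 𝟘, there are n + 1 columns 𝟙 of which the first has been
-- flipped in row ρ and the last in row ρ′ (both, if n = 0): ℋ (3 + n) is
-- segment 1F n 1F and 𝒟 (3 + n) is segment 1F n 0F.
segment : Fin 2 → ℕ → Fin 2 → Word
segment ρ n ρ′ = 𝟘 ∷ run (flip ρ 𝟙) n ρ′ ++ 𝟘 ∷ []

run-length : ∀ a n ρ → length (run a n ρ ++ 𝟘 ∷ []) ≡ 2 + n
run-length a zero    ρ = refl
run-length a (suc n) ρ = cong suc (run-length 𝟙 n ρ)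

run-swap : ∀ a n ρ → map swap (run a n ρ ++ 𝟘 ∷ []) ≡ run (swap a) n (opposite ρ) ++ 𝟘 ∷ []
run-swap a zero    ρ = cong (_∷ _) (sym (flip-swap ρ a))
run-swap a (suc n) ρ = cong (swap a ∷_) (run-swap 𝟙 n ρ)

run-Stable : ∀ n ρ → T (headNonzero (run 𝟙 n ρ ++ 𝟘 ∷ [])) × Stable true (run 𝟙 n ρ ++ 𝟘 ∷ [])
run-Stable zero    0F = tt , tt , tt , tt
run-Stable zero    1F = tt , tt , tt , tt
run-Stable (suc n) ρ with h , s ← run-Stable n ρ = tt , full _ h , s
  where
  full : ∀ x → T x → T (stable true 𝟙 x)
  full true _ = tt

segment-WellFormed : ∀ ρ n ρ′ → WellFormed (segment ρ n ρ′)
segment-WellFormed 0F zero    0F = tt , tt , tt , tt , tt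
segment-WellFormed 0F zero    1F = tt , tt , tt , tt , tt
segment-WellFormed 1F zero    0F = tt , tt , tt , tt , tt
segment-WellFormed 1F zero    1F = tt , tt , tt , tt , tt
segment-WellFormed 0F (suc n) ρ′ = tt , tt , tt , proj₂ (run-Stable n ρ′)
segment-WellFormed 1F (suc n) ρ′ = tt , tt , tt , proj₂ (run-Stable n ρ′)

flip-comm : ∀ r ρ a → flip r (flip ρ a) ≡ flip ρ (flip r a)
flip-comm 0F 0F a = refl
flip-comm 0F 1F a = refl
flip-comm 1F 0F a = refl
flip-comm 1F 1F a = refl

-- The played column splits the `n + 1` columns into `c + 1` on its left and `l + 1` on its right,
-- and both new ends are flipped in row `r`.
run-Move⁻ : ∀ {r c w} a n ρ → Move r c (run a n ρ ++ 𝟘 ∷ []) w →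
  ∃[ l ] n ≡ 2 + (c + l) × w ≡ run a c r ++ 𝟘 ∷ run (flip r 𝟙) l ρ ++ 𝟘 ∷ []
run-Move⁻ a zero ρ (there (there ()))
-- Here the right part is a single column, flipped as the old end first and by the move second, in
-- the opposite order to `run`.
run-Move⁻ {r} a 2 ρ (here _) =
  0 , refl , cong (λ x → flip r a ∷ 𝟘 ∷ x ∷ 𝟘 ∷ []) (flip-comm r ρ 𝟙)
run-Move⁻ a (suc (suc (suc l))) ρ (here _) = suc l , refl , refl
run-Move⁻ a 1             0F (there m) with () ← run-Move⁻ 𝟙 0 0F m
run-Move⁻ a 1             1F (there m) with () ← run-Move⁻ 𝟙 0 1F m
run-Move⁻ a (suc (suc n)) ρ  (there m) with l , eq , refl ← run-Move⁻ 𝟙 (suc n) ρ m =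
  l , cong suc eq , refl

-- The column next to the played one, c columns away from the end column a.
inner : Column → ℕ → Column
inner a zero    = a
inner a (suc _) = 𝟙

run-Move⁺ : ∀ r c a l ρ → T (playable r (inner a c) (inner (flip ρ 𝟙) l)) →
  Move r c (run a (2 + (c + l)) ρ ++ 𝟘 ∷ []) (run a c r ++ 𝟘 ∷ run (flip r 𝟙) l ρ ++ 𝟘 ∷ [])
run-Move⁺ r zero          a zero    ρ p =
  subst (λ x → Move r 0 (a ∷ 𝟙 ∷ flip ρ 𝟙 ∷ 𝟘 ∷ []) (flip r a ∷ 𝟘 ∷ x ∷ 𝟘 ∷ [])) (flip-comm r ρ 𝟙) (here p)
run-Move⁺ r zero          a (suc l) ρ p = here p
run-Move⁺ r 1             a l       ρ p = there (run-Move⁺ r 0 𝟙 l ρ p)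
run-Move⁺ r (suc (suc c)) a l       ρ p = there (run-Move⁺ r (suc c) 𝟙 l ρ p)

Move-𝟘 : ∀ {r c v w} → Move r c (𝟘 ∷ v) w → ∃[ c′ ] ∃[ v′ ] w ≡ 𝟘 ∷ v′ × Move r c′ v v′
Move-𝟘 (there m) = _ , _ , refl , m

-- With `i = 3 + c` and `m + 1 - i = 3 + l`, this is the value `x_i` for `r = 1F` and `y_i` for
-- `r = 0F`.
summands : Fin 2 → ℕ → ℕ → ℕ
summands r c l = nim (segment 1F c r) ⊕ nim (segment 1F l r)

-- The part to the right of the new `𝟘` begins with an end flipped in row `r` and keeps the old end
-- flipped in row 1. For `r = 0F`, exchanging the rows gives the form of `𝒟`.
nim-segment-comm : ∀ r l → nim (segment r l 1F) ≡ nim (segment 1F l r)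
nim-segment-comm 1F l = refl
nim-segment-comm 0F l = trans (sym (nim-swap (segment 0F l 1F) (segment-WellFormed 0F l 1F)))
  (cong (λ w → nim (𝟘 ∷ w)) (run-swap (flip 0F 𝟙) l 1F))

segment-Move⁻ : ∀ {n r c w} → Move r c (segment 1F n 1F) w →
  ∃[ c ] ∃[ l ] n ≡ 2 + (c + l) × nim w ≡ summands r c l
segment-Move⁻ {n} {r} m
  with c , _ , refl , m′ ← Move-𝟘 m
  with l , eq , refl ← run-Move⁻ (flip 1F 𝟙) n 1F m′
  = c , l , eq , trans
    (nim-++ (𝟘 ∷ run (flip 1F 𝟙) c r) _ (Move-WellFormed m (segment-WellFormed 1F n 1F)))
    (cong (nim (segment 1F c r) ⊕_) (nim-segment-comm r l))

-- The end columns keep their weight in row 0, so the hypothesis always holds for `r = 0F`. For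
-- `r = 1F` it fails only if both neighbours of the played column are ends, that is, for
-- `c = l = 0`.
segment-Move⁺ : ∀ r c l → T (playable r (inner (flip 1F 𝟙) c) (inner (flip 1F 𝟙) l)) →
  ∃[ r′ ] ∃[ c′ ] ∃[ w ] Move r′ c′ (segment 1F (2 + (c + l)) 1F) w × nim w ≡ summands r c l
segment-Move⁺ r c l p = r , suc c , _ , m , trans
  (nim-++ (𝟘 ∷ run (flip 1F 𝟙) c r) _ (Move-WellFormed m (segment-WellFormed 1F (2 + (c + l)) 1F)))
  (cong (nim (segment 1F c r) ⊕_) (nim-segment-comm r l))
  where
  m = there (run-Move⁺ r c (flip 1F 𝟙) l 1F p)

-- For c = l = 0 the move in row 1 is illegal, but like the one in row 0 it would
-- leave two equal summands.
segment-reaches : ∀ r c l →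
  ∃[ r′ ] ∃[ c′ ] ∃[ w ] Move r′ c′ (segment 1F (2 + (c + l)) 1F) w × nim w ≡ summands r c l
segment-reaches 0F zero    zero    = segment-Move⁺ 0F 0 0 tt
segment-reaches 0F zero    (suc l) = segment-Move⁺ 0F 0 (suc l) tt
segment-reaches 0F (suc c) zero    = segment-Move⁺ 0F (suc c) 0 tt
segment-reaches 0F (suc c) (suc l) = segment-Move⁺ 0F (suc c) (suc l) tt
segment-reaches 1F zero    (suc l) = segment-Move⁺ 1F 0 (suc l) tt
segment-reaches 1F (suc c) zero    = segment-Move⁺ 1F (suc c) 0 tt
segment-reaches 1F (suc c) (suc l) = segment-Move⁺ 1F (suc c) (suc l) tt
segment-reaches 1F zero    zero    =
  let r , c , w , m , eq = segment-Move⁺ 0F 0 0 tt in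
  r , c , w , m , trans eq (trans (n⊕n≡0 (nim (segment 1F 0 0F))) (sym (n⊕n≡0 (nim (segment 1F 0 1F)))))

-- Identification of `ℋ` and `𝒟` with segments

-- The right-hand side mirrors the Boolean tests to which membership in the lists of `gridPosition`
-- reduces. The bound excludes columns beyond the end, where the default `𝟘` would make the
-- left-hand side true.
run-bit : ∀ n ρ i j → j ≤ suc n → not (bit (column (run 𝟙 n ρ ++ 𝟘 ∷ []) j) i) ≡
  (does (i Fin.≟ ρ) ∧ (j ≡ᵇ n)) ∨ (j ≡ᵇ suc n)
run-bit zero    0F 0F 0 _ = refl
run-bit zero    0F 1F 0 _ = refl
run-bit zero    1F 0F 0 _ = refl
run-bit zero    1F 1F 0 _ = refl
run-bit zero    0F 0F 1 _ = refl
run-bit zero    0F 1F 1 _ = refl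
run-bit zero    1F 0F 1 _ = refl
run-bit zero    1F 1F 1 _ = refl
run-bit zero    ρ  i  (suc (suc j)) (s≤s ())
run-bit (suc n) 0F 0F 0 _ = refl
run-bit (suc n) 0F 1F 0 _ = refl
run-bit (suc n) 1F 0F 0 _ = refl
run-bit (suc n) 1F 1F 0 _ = refl
run-bit (suc n) ρ  i  (suc j) (s≤s j≤) = run-bit n ρ i j j≤


segment-length : ∀ ρ n ρ′ → length (segment ρ n ρ′) ≡ 3 + n
segment-length ρ n ρ′ = cong suc (run-length (flip ρ 𝟙) n ρ′)

𝒢-render : ∀ {m V} w → length w ≡ m → V ≗ render w → 𝒢 ⟨ grid₂ m , V ⟩ ≡ nim w
𝒢-render {m} w length≡ V≗ = trans (nimber-cong (grid₂ m) V≗) (nim-render w length≡)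

𝒢-ℋ : ∀ n → 𝒢 (ℋ (3 + n)) ≡ nim (segment 1F n 1F)
-- The only inner column is flipped twice in row 1 and so remains `𝟙`, in accordance with the
-- separate clause for `ℋ 3`.
𝒢-ℋ zero = 𝒢-render {V = Position.zeroSet (ℋ 3)} (segment 1F 0 1F) refl λ
  { (0F , 0F) → refl ; (0F , 1F) → refl ; (0F , 2F) → refl
  ; (1F , 0F) → refl ; (1F , 1F) → refl ; (1F , 2F) → refl }
𝒢-ℋ (suc n) = 𝒢-render {V = Position.zeroSet (ℋ (4 + n))} (segment 1F (suc n) 1F)
  (segment-length 1F (suc n) 1F) zeros
  where
  zeros : Position.zeroSet (ℋ (4 + n)) ≗ render (segment 1F (suc n) 1F)
  zeros (0F , 0F) = refl
  zeros (0F , 1F) = refl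
  zeros (0F , suc (suc j)) = trans (∨-identityʳ (toℕ j ≡ᵇ suc n))
    (sym (run-bit n 1F 0F (toℕ j) (s≤s⁻¹ (Fin.toℕ<n j))))
  zeros (1F , 0F) = refl
  zeros (1F , 1F) = refl
  zeros (1F , suc (suc j)) = trans (cong ((toℕ j ≡ᵇ n) ∨_) (∨-identityʳ (toℕ j ≡ᵇ suc n)))
    (sym (run-bit n 1F 1F (toℕ j) (s≤s⁻¹ (Fin.toℕ<n j))))

𝒢-𝒟 : ∀ n → 𝒢 (𝒟 (3 + n)) ≡ nim (segment 1F n 0F)
𝒢-𝒟 n = 𝒢-render {V = Position.zeroSet (𝒟 (3 + n))} (segment 1F n 0F) (segment-length 1F n 0F) (zeros n)
  where
  zeros : ∀ n → Position.zeroSet (𝒟 (3 + n)) ≗ render (segment 1F n 0F)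
  zeros zero    (0F , 0F) = refl
  zeros zero    (0F , 1F) = refl
  zeros zero    (0F , 2F) = refl
  zeros zero    (1F , 0F) = refl
  zeros zero    (1F , 1F) = refl
  zeros zero    (1F , 2F) = refl
  zeros (suc n) (0F , 0F) = refl
  zeros (suc n) (0F , 1F) = refl
  zeros (suc n) (0F , suc (suc j)) = trans (cong ((toℕ j ≡ᵇ n) ∨_) (∨-identityʳ (toℕ j ≡ᵇ suc n)))
    (sym (run-bit n 0F 0F (toℕ j) (s≤s⁻¹ (Fin.toℕ<n j))))
  zeros (suc n) (1F , 0F) = refl
  zeros (suc n) (1F , 1F) = refl
  zeros (suc n) (1F , suc (suc j)) = trans (∨-identityʳ (toℕ j ≡ᵇ suc n))
    (sym (run-bit n 0F 1F (toℕ j) (s≤s⁻¹ (Fin.toℕ<n j))))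

-- Index ranges and the mex formula

-- The two parts share the new column `𝟘`, so their lengths `3 + c` and `3 + l` add up to `m + 1`.
complementary-length : ∀ c l → (3 + (2 + (c + l))) + 1 ∸ (3 + c) ≡ 3 + l
complementary-length c l = trans (cong (_∸ c) (trans (cong (λ x → 2 + x) (+-comm (c + l) 1)) eq)) (m+n∸m≡n c (3 + l))
  where
  eq : 3 + (c + l) ≡ c + (3 + l)
  eq = trans (sym (+-assoc 3 c l)) (trans (cong (_+ l) (+-comm 3 c)) (+-assoc c 3 l))

𝒢-ℋ⊕ : ∀ c l → 𝒢 (ℋ (3 + c)) ⊕ 𝒢 (ℋ (3 + (2 + (c + l)) + 1 ∸ (3 + c))) ≡ summands 1F c l
𝒢-ℋ⊕ c l = cong₂ _⊕_ (𝒢-ℋ c) (trans (cong (λ k → 𝒢 (ℋ k)) (complementary-length c l)) (𝒢-ℋ l))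

𝒢-𝒟⊕ : ∀ c l → 𝒢 (𝒟 (3 + c)) ⊕ 𝒢 (𝒟 (3 + (2 + (c + l)) + 1 ∸ (3 + c))) ≡ summands 0F c l
𝒢-𝒟⊕ c l = cong₂ _⊕_ (𝒢-𝒟 c) (trans (cong (λ k → 𝒢 (𝒟 k)) (complementary-length c l)) (𝒢-𝒟 l))

-- The list `3 ⋯ s` has `suc s ∸ 3` entries, and `c ≤ l` makes `3 + c` at most half of
-- `m + 1 = 6 + (c + l)`.
c≤l⇒index : ∀ c l → c ≤ l → c < suc ((3 + (2 + (c + l)) + 1) / 2) ∸ 3
c≤l⇒index c l c≤l = ∸-monoˡ-≤ 3 (s≤s (begin
  3 + c                              ≡⟨ m*n/n≡m (3 + c) 2 ⟨
  (3 + c) * 2 / 2                    ≤⟨ /-monoˡ-≤ 2 bound ⟩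
  (3 + (2 + (c + l)) + 1) / 2        ∎))
  where
  open ≤-Reasoning
  bound : (3 + c) * 2 ≤ 3 + (2 + (c + l)) + 1
  bound = begin
    6 + c * 2           ≡⟨ cong (6 +_) (trans (*-comm c 2) (cong (c +_) (+-identityʳ c))) ⟩
    6 + (c + c)         ≤⟨ +-monoʳ-≤ 6 (+-monoʳ-≤ c c≤l) ⟩
    6 + (c + l)         ≡⟨ +-comm (5 + (c + l)) 1 ⟨
    5 + (c + l) + 1     ∎

m<n∸o⇒o+m<n : ∀ {m} o n → m < n ∸ o → o + m < n
m<n∸o⇒o+m<n zero    n       m<n   = m<n
m<n∸o⇒o+m<n (suc o) (suc n) m<n∸o = s≤s (m<n∸o⇒o+m<n o n m<n∸o)

index⇒complement : ∀ n c → c < suc ((3 + n + 1) / 2) ∸ 3 → ∃[ l ] n ≡ 2 + (c + l)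
index⇒complement n c c< = n ∸ (2 + c) , sym (m+[n∸m]≡n 2+c≤n)
  where
  open ≤-Reasoning
  3+c≤s : 3 + c ≤ (3 + n + 1) / 2
  3+c≤s = s≤s⁻¹ (m<n∸o⇒o+m<n 3 _ c<)
  6+2c≤ : 4 + (2 + c) ≤ 4 + n
  6+2c≤ = begin
    -- Only `2 + c ≤ n` is wanted, so the bound on `c * 2` is weakened to one on `c`.
    6 + c                        ≤⟨ +-monoʳ-≤ 6 (m≤m*n c 2) ⟩
    (3 + c) * 2                  ≤⟨ *-monoˡ-≤ 2 3+c≤s ⟩
    (3 + n + 1) / 2 * 2          ≤⟨ m/n*n≤m (3 + n + 1) 2 ⟩
    3 + n + 1                    ≡⟨ +-comm (3 + n) 1 ⟩
    4 + n                        ∎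
  2+c≤n : 2 + c ≤ n
  2+c≤n = +-cancelˡ-≤ 4 (2 + c) n 6+2c≤

summands-comm : ∀ r c l → summands r c l ≡ summands r l c
summands-comm r c l = ⊕-comm (nim (segment 1F c r)) (nim (segment 1F l r))

proposition3p3 : (m : ℕ) → 3 ≤ m →
    let s : ℕ
        s = (m + 1) / 2
        x : ℕ → ℕ
        x = λ i → 𝒢 (ℋ i) ⊕ 𝒢 (ℋ (m + 1 ∸ i))
        y : ℕ → ℕ
        y = λ i → 𝒢 (𝒟 i) ⊕ 𝒢 (𝒟 (m + 1 ∸ i))
    in 𝒢 (ℋ m) ≡ mex (map x (3 ⋯ s) ++ map y (3 ⋯ s))
proposition3p3 (suc (suc (suc n))) (s≤s (s≤s (s≤s z≤n))) =
  trans (𝒢-ℋ n) (nim-≡ (segment-WellFormed 1F n 1F) (mex xys) avoids (λ k< → reached (mex-least xys k<)))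
  where
  m = 3 + n
  s = (m + 1) / 2
  x y : ℕ → ℕ
  x i = 𝒢 (ℋ i) ⊕ 𝒢 (ℋ (m + 1 ∸ i))
  y i = 𝒢 (𝒟 i) ⊕ 𝒢 (𝒟 (m + 1 ∸ i))
  xys = map x (3 ⋯ s) ++ map y (3 ⋯ s)

  listed≤ : ∀ r c l → c ≤ l → n ≡ 2 + (c + l) → summands r c l ∈ xys
  listed≤ 1F c l c≤l refl = ∈-++⁺ˡ (subst (_∈ map x (3 ⋯ s)) (𝒢-ℋ⊕ c l)
    (∈-map⁺ x (∈-applyUpTo⁺ (3 +_) (c≤l⇒index c l c≤l))))
  listed≤ 0F c l c≤l refl = ∈-++⁺ʳ (map x (3 ⋯ s)) (subst (_∈ map y (3 ⋯ s)) (𝒢-𝒟⊕ c l)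
    (∈-map⁺ y (∈-applyUpTo⁺ (3 +_) (c≤l⇒index c l c≤l))))

  -- The lists stop at `i = s`; a move whose left part is the longer one is covered by exchanging
  -- the summands.
  listed : ∀ r c l → n ≡ 2 + (c + l) → summands r c l ∈ xys
  listed r c l n≡ = [ (λ c≤l → listed≤ r c l c≤l n≡) ,
    (λ l≤c → subst (_∈ xys) (summands-comm r l c)
      (listed≤ r l c l≤c (trans n≡ (cong (2 +_) (+-comm c l))))) ]′ (≤-total c l)

  reached : ∀ {k} → k ∈ xys → ∃[ r ] ∃[ c ] ∃[ w ] Move r c (segment 1F n 1F) w × nim w ≡ k
  reached k∈ with ∈-++⁻ (map x (3 ⋯ s)) k∈
  reached k∈ | inj₁ k∈x
    with _ , i∈ , refl ← ∈-map⁻ x k∈x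
    with c , c< , refl ← ∈-applyUpTo⁻ (3 +_) i∈
    with l , refl ← index⇒complement n c c<
    = let r , c′ , w , mv , eq = segment-reaches 1F c l in r , c′ , w , mv , trans eq (sym (𝒢-ℋ⊕ c l))
  reached k∈ | inj₂ k∈y
    with _ , i∈ , refl ← ∈-map⁻ y k∈y
    with c , c< , refl ← ∈-applyUpTo⁻ (3 +_) i∈
    with l , refl ← index⇒complement n c c<
    = let r , c′ , w , mv , eq = segment-reaches 0F c l in r , c′ , w , mv , trans eq (sym (𝒢-𝒟⊕ c l))

  avoids : ∀ {r c w} → Move r c (segment 1F n 1F) w → nim w ≢ mex xys
  avoids mv eq = let c , l , n≡ , eq′ = segment-Move⁻ mv in
    mex-∉ xys (subst (_∈ xys) (trans (sym eq′) eq) (listed _ c l n≡))
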